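{- Let $G$ be the $4$-regular graph with the seven vertices $x_1,x_2,x_3,y_1,y_2,y_3,y_4$ whose edges are $\{x_i,y_j\}$ for all $i\in\{1,2,3\}$, $j\in\{1,2,3,4\}$, together with $\{y_1,y_2\}$ and $\{y_3,y_4\}$. For $n\ge3$ let $G_n=G\times C_n$ be the Cartesian product of $G$ with the cycle $C_n$ on $n$ vertices. Then $(G_n)_{n\ge3}$ is an infinite family of finite $6$-regular graphs of increasing size, every $G_n$ satisfies $CD(0,\infty)$, and no $G_n$ is a Cayley graph.
   Context: For a locally finite simple graph $(V,E)$ and $f:V\to\mathbb R$ put $\Delta f(x)=\sum_{y\sim x}(f(y)-f(x))$ (non-normalized Laplacian), and for $f,g:V\to\mathbb R$ put $2\Gamma(f,g)=\Delta(fg)-f\Delta g-g\Delta f$, $2\Gamma_2(f,g)=\Delta\Gamma(f,g)-\Gamma(f,\Delta g)-\Gamma(\Delta f,g)$, $\Gamma(f)=\Gamma(f,f)$, $\Gamma_2(f)=\Gamma_2(f,f)$. The graph satisfies $CD(0,\infty)$ if $\Gamma_2(f)(x)\ge0$ for all $f:V\to\mathbb R$ and all $x\in V$. Cartesian product: for graphs $(V_1,E_1)$, $(V_2,E_2)$ it has vertex set $V_1\times V_2$, and $(u_1,v_1),(u_2,v_2)$ are adjacent iff either $u_1=u_2$ and $\{v_1,v_2\}\in E_2$, or $\{u_1,u_2\}\in E_1$ and $v_1=v_2$. A Cayley graph $\mathrm{Cay}(\Gamma,S)$ of a group $\Gamma$ with a finite symmetric generating set $S\subset\Gamma$ not containing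 the identity has vertex set $\Gamma$, with $g$ adjacent to $gs$ for all $g\in\Gamma$, $s\in S$; "is a Cayley graph" means isomorphic to such a graph. -}

module Defs where

open import Algebra.Bundles using (Group)
open import Data.Fin.Base using (Fin; toℕ)
open import Data.Fin.Patterns using (0F; 1F; 2F; 3F)
open import Data.Fin.Properties using (toℕ-injective; toℕ-fromℕ<; toℕ<n)
open import Data.List.Base using (List; []; _∷_; _++_; map; foldr; length)
open import Data.List.Membership.Propositional using (_∈_)
open import Data.List.Membership.Propositional.Properties
  using (∈-map⁺; ∈-map⁻; ∈-++⁺ˡ; ∈-++⁺ʳ; ∈-++⁻)
import Data.List.Membership.Setoid as SetoidMembership
open import Data.List.Relation.Unary.All using ([]; _∷_)
open import Data.List.Relation.Unary.Any using (here; there)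
open import Data.List.Relation.Unary.Unique.Propositional using (Unique; []; _∷_)
open import Data.List.Relation.Unary.Unique.Propositional.Properties using (map⁺; ++⁺)
open import Data.Nat.Base as ℕ using (ℕ; zero; suc; NonZero; s≤s; z≤n)
open import Data.Nat.DivMod
  using (_%_; _mod_; m<n⇒m%n≡m; n%n≡0; m%n<n; [m+n]%n≡m%n)
import Data.Nat.Properties as ℕ
open import Data.Product.Base using (∃-syntax; Σ-syntax; _×_; _,_; proj₁; proj₂)
open import Data.Rational.Base as ℚ using (ℚ; 0ℚ; 1ℚ; ½; Positive; positive; 1/_)
import Data.Rational.Properties as ℚ
open import Data.Rational.Solver using (module +-*-Solver)
open import Data.Sum.Base using (_⊎_; inj₁; inj₂)
open import Function.Base using (_∘_)
open import Function.Bundles using (_↔_; _⇔_; mk⇔; Equivalence)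
open import Level using (0ℓ)
open import Relation.Binary.Construct.Closure.Symmetric
  using (SymClosure; fwd; bwd; symmetric)
open import Relation.Binary.Core using (Rel)
open import Relation.Binary.Definitions using (Symmetric; Irreflexive)
open import Relation.Binary.Morphism.Structures using (IsOrderIsomorphism)
open import Relation.Binary.PropositionalEquality
  using (_≡_; _≢_; refl; sym; trans; cong; subst; module ≡-Reasoning)
open import Relation.Nullary.Negation using (¬_)

-- Real numbers, as Cauchy sequences of rationals (with a modulus).  Two
-- sequences may represent the same real; everything below only depends
-- on reals through the order _≤ᴿ_, which does not distinguish them.

IsCauchy : (ℕ → ℚ) → Set
IsCauchy x = ∀ ε → 0ℚ ℚ.< ε →
  ∃[ N ] (∀ m n → N ℕ.≤ m → N ℕ.≤ n → ℚ.∣ x m ℚ.- x n ∣ ℚ.< ε)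

record ℝ : Set where
  constructor mkℝ
  field
    seq    : ℕ → ℚ
    cauchy : IsCauchy seq

open ℝ public

private
  half>0 : ∀ ε → 0ℚ ℚ.< ε → 0ℚ ℚ.< ½ ℚ.* ε
  half>0 ε ε>0 = ℚ.positive⁻¹ (½ ℚ.* ε) {{ℚ.pos*pos⇒pos ½ ε {{positive ε>0}}}}

  half+half : ∀ ε → ½ ℚ.* ε ℚ.+ ½ ℚ.* ε ≡ ε
  half+half ε = trans (sym (ℚ.*-distribʳ-+ ε ½ ½)) (ℚ.*-identityˡ ε)

  rearrange-+ : ∀ a b c d →
    (a ℚ.+ b) ℚ.- (c ℚ.+ d) ≡ (a ℚ.- c) ℚ.+ (b ℚ.- d)
  rearrange-+ = solve 4 (λ a b c d → (a :+ b) :- (c :+ d) := (a :- c) :+ (b :- d)) refl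
    where open +-*-Solver

  rearrange-neg : ∀ a b → (ℚ.- a) ℚ.- (ℚ.- b) ≡ ℚ.- (a ℚ.- b)
  rearrange-neg = solve 2 (λ a b → (:- a) :- (:- b) := :- (a :- b)) refl
    where open +-*-Solver

  rearrange-* : ∀ a b c d →
    (a ℚ.* b) ℚ.- (c ℚ.* d) ≡ a ℚ.* (b ℚ.- d) ℚ.+ d ℚ.* (a ℚ.- c)
  rearrange-* = solve 4 (λ a b c d →
    (a :* b) :- (c :* d) := a :* (b :- d) :+ d :* (a :- c)) refl
    where open +-*-Solver

  a≡b+[a-b] : ∀ a b → a ≡ b ℚ.+ (a ℚ.- b)
  a≡b+[a-b] = solve 2 (λ a b → a := b :+ (a :- b)) refl
    where open +-*-Solver

  const-cauchy : ∀ q → IsCauchy (λ _ → q)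
  const-cauchy q ε ε>0 = 0 , λ _ _ _ _ →
    subst (ℚ._< ε) (sym (cong ℚ.∣_∣ (ℚ.+-inverseʳ q))) ε>0

  neg-cauchy : ∀ {x} → IsCauchy x → IsCauchy (λ n → ℚ.- x n)
  neg-cauchy {x} cx ε ε>0 with cx ε ε>0
  ... | N , h = N , λ m n N≤m N≤n → subst (ℚ._< ε)
    (sym (trans (cong ℚ.∣_∣ (rearrange-neg (x m) (x n))) (ℚ.∣-p∣≡∣p∣ (x m ℚ.- x n))))
    (h m n N≤m N≤n)

  +-cauchy : ∀ {x y} → IsCauchy x → IsCauchy y → IsCauchy (λ n → x n ℚ.+ y n)
  +-cauchy {x} {y} cx cy ε ε>0 with cx _ (half>0 ε ε>0) | cy _ (half>0 ε ε>0)
  ... | M , h | N , k = M ℕ.⊔ N , λ m n M⊔N≤m M⊔N≤n → begin-strict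
    ℚ.∣ (x m ℚ.+ y m) ℚ.- (x n ℚ.+ y n) ∣
      ≡⟨ cong ℚ.∣_∣ (rearrange-+ (x m) (y m) (x n) (y n)) ⟩
    ℚ.∣ (x m ℚ.- x n) ℚ.+ (y m ℚ.- y n) ∣
      ≤⟨ ℚ.∣p+q∣≤∣p∣+∣q∣ (x m ℚ.- x n) (y m ℚ.- y n) ⟩
    ℚ.∣ x m ℚ.- x n ∣ ℚ.+ ℚ.∣ y m ℚ.- y n ∣
      <⟨ ℚ.+-mono-< (h m n (ℕ.m⊔n≤o⇒m≤o M N M⊔N≤m) (ℕ.m⊔n≤o⇒m≤o M N M⊔N≤n))
                    (k m n (ℕ.m⊔n≤o⇒n≤o M N M⊔N≤m) (ℕ.m⊔n≤o⇒n≤o M N M⊔N≤n)) ⟩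
    ½ ℚ.* ε ℚ.+ ½ ℚ.* ε
      ≡⟨ half+half ε ⟩
    ε ∎
    where open ℚ.≤-Reasoning

  bounded : ∀ {x} → IsCauchy x →
    Σ[ B ∈ ℚ ] Positive B × ∃[ N ] (∀ n → N ℕ.≤ n → ℚ.∣ x n ∣ ℚ.≤ B)
  bounded {x} cx with cx 1ℚ (ℚ.positive⁻¹ 1ℚ)
  ... | N , h = ℚ.∣ x N ∣ ℚ.+ 1ℚ , positive B>0 , N , λ n N≤n → begin
    ℚ.∣ x n ∣
      ≡⟨ cong ℚ.∣_∣ (a≡b+[a-b] (x n) (x N)) ⟩
    ℚ.∣ x N ℚ.+ (x n ℚ.- x N) ∣
      ≤⟨ ℚ.∣p+q∣≤∣p∣+∣q∣ (x N) (x n ℚ.- x N) ⟩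
    ℚ.∣ x N ∣ ℚ.+ ℚ.∣ x n ℚ.- x N ∣
      ≤⟨ ℚ.+-monoʳ-≤ ℚ.∣ x N ∣ (ℚ.<⇒≤ (h n N N≤n ℕ.≤-refl)) ⟩
    ℚ.∣ x N ∣ ℚ.+ 1ℚ ∎
    where
    open ℚ.≤-Reasoning
    B>0 : 0ℚ ℚ.< ℚ.∣ x N ∣ ℚ.+ 1ℚ
    B>0 = ℚ.+-mono-≤-< (ℚ.0≤∣p∣ (x N)) (ℚ.positive⁻¹ 1ℚ)

  scale-down : ∀ B → Positive B → ∀ ε → 0ℚ ℚ.< ε →
    Σ[ δ ∈ ℚ ] 0ℚ ℚ.< δ × B ℚ.* δ ≡ ε
  scale-down B B>0 ε ε>0 = B⁻¹ ℚ.* ε , δ>0 ,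
    trans (sym (ℚ.*-assoc B B⁻¹ ε))
      (trans (cong (ℚ._* ε) (ℚ.*-inverseʳ B {{B≢0}})) (ℚ.*-identityˡ ε))
    where
    B≢0 : ℚ.NonZero B
    B≢0 = ℚ.pos⇒nonZero B {{B>0}}
    B⁻¹ : ℚ
    B⁻¹ = (1/ B) {{B≢0}}
    δ>0 : 0ℚ ℚ.< B⁻¹ ℚ.* ε
    δ>0 = ℚ.positive⁻¹ _
      {{ℚ.pos*pos⇒pos B⁻¹ {{ℚ.1/pos⇒pos B {{B>0}}}} ε {{positive ε>0}}}}

  ∣a*b∣<ε : ∀ {a b B δ ε} → Positive B → ℚ.∣ a ∣ ℚ.≤ B → ℚ.∣ b ∣ ℚ.< δ →
    B ℚ.* δ ≡ ε → ℚ.∣ a ℚ.* b ∣ ℚ.< ε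
  ∣a*b∣<ε {a} {b} {B} {δ} {ε} B>0 a≤B b<δ Bδ≡ε = begin-strict
    ℚ.∣ a ℚ.* b ∣         ≡⟨ ℚ.∣p*q∣≡∣p∣*∣q∣ a b ⟩
    ℚ.∣ a ∣ ℚ.* ℚ.∣ b ∣   ≤⟨ ℚ.*-monoʳ-≤-nonNeg ℚ.∣ b ∣ {{ℚ.∣-∣-nonNeg b}} a≤B ⟩
    B ℚ.* ℚ.∣ b ∣         <⟨ ℚ.*-monoʳ-<-pos B {{B>0}} b<δ ⟩
    B ℚ.* δ               ≡⟨ Bδ≡ε ⟩
    ε ∎
    where open ℚ.≤-Reasoning

  *-cauchy : ∀ {x y} → IsCauchy x → IsCauchy y → IsCauchy (λ n → x n ℚ.* y n)
  *-cauchy {x} {y} cx cy ε ε>0 = N , λ m n N≤m N≤n → begin-strict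
    ℚ.∣ (x m ℚ.* y m) ℚ.- (x n ℚ.* y n) ∣
      ≡⟨ cong ℚ.∣_∣ (rearrange-* (x m) (y m) (x n) (y n)) ⟩
    ℚ.∣ x m ℚ.* (y m ℚ.- y n) ℚ.+ y n ℚ.* (x m ℚ.- x n) ∣
      ≤⟨ ℚ.∣p+q∣≤∣p∣+∣q∣ (x m ℚ.* (y m ℚ.- y n)) (y n ℚ.* (x m ℚ.- x n)) ⟩
    ℚ.∣ x m ℚ.* (y m ℚ.- y n) ∣ ℚ.+ ℚ.∣ y n ℚ.* (x m ℚ.- x n) ∣
      <⟨ ℚ.+-mono-<
           (∣a*b∣<ε {x m} {y m ℚ.- y n} B>0 (x≤B m (lower₁ N≤m)) (y-close m n (lower₄ N≤m) (lower₄ N≤n)) Bδ)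
           (∣a*b∣<ε {y n} {x m ℚ.- x n} C>0 (y≤C n (lower₂ N≤n)) (x-close m n (lower₃ N≤m) (lower₃ N≤n)) Cη) ⟩
    ½ ℚ.* ε ℚ.+ ½ ℚ.* ε
      ≡⟨ half+half ε ⟩
    ε ∎
    where
    open ℚ.≤-Reasoning
    bx = bounded {x} cx
    by = bounded {y} cy
    B = proj₁ bx
    C = proj₁ by
    B>0 = proj₁ (proj₂ bx)
    C>0 = proj₁ (proj₂ by)
    N₁ = proj₁ (proj₂ (proj₂ bx))
    N₂ = proj₁ (proj₂ (proj₂ by))
    x≤B = proj₂ (proj₂ (proj₂ bx))
    y≤C = proj₂ (proj₂ (proj₂ by))
    sδ = scale-down B B>0 (½ ℚ.* ε) (half>0 ε ε>0)
    sη = scale-down C C>0 (½ ℚ.* ε) (half>0 ε ε>0)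
    Bδ = proj₂ (proj₂ sδ)
    Cη = proj₂ (proj₂ sη)
    xη = cx (proj₁ sη) (proj₁ (proj₂ sη))
    yδ = cy (proj₁ sδ) (proj₁ (proj₂ sδ))
    N₃ = proj₁ xη
    N₄ = proj₁ yδ
    x-close = proj₂ xη
    y-close = proj₂ yδ
    N : ℕ
    N = (N₁ ℕ.⊔ N₂) ℕ.⊔ (N₃ ℕ.⊔ N₄)
    lower₁ : ∀ {m} → N ℕ.≤ m → N₁ ℕ.≤ m
    lower₁ = ℕ.m⊔n≤o⇒m≤o N₁ N₂ ∘ ℕ.m⊔n≤o⇒m≤o (N₁ ℕ.⊔ N₂) (N₃ ℕ.⊔ N₄)
    lower₂ : ∀ {m} → N ℕ.≤ m → N₂ ℕ.≤ m
    lower₂ = ℕ.m⊔n≤o⇒n≤o N₁ N₂ ∘ ℕ.m⊔n≤o⇒m≤o (N₁ ℕ.⊔ N₂) (N₃ ℕ.⊔ N₄)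
    lower₃ : ∀ {m} → N ℕ.≤ m → N₃ ℕ.≤ m
    lower₃ = ℕ.m⊔n≤o⇒m≤o N₃ N₄ ∘ ℕ.m⊔n≤o⇒n≤o (N₁ ℕ.⊔ N₂) (N₃ ℕ.⊔ N₄)
    lower₄ : ∀ {m} → N ℕ.≤ m → N₄ ℕ.≤ m
    lower₄ = ℕ.m⊔n≤o⇒n≤o N₃ N₄ ∘ ℕ.m⊔n≤o⇒n≤o (N₁ ℕ.⊔ N₂) (N₃ ℕ.⊔ N₄)

infixl 6 _+ᴿ_ _-ᴿ_
infixl 7 _*ᴿ_
infix  8 -ᴿ_
infix  4 _≤ᴿ_

fromℚ : ℚ → ℝ
fromℚ q = mkℝ (λ _ → q) (const-cauchy q)

_+ᴿ_ : ℝ → ℝ → ℝ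
a +ᴿ b = mkℝ (λ n → seq a n ℚ.+ seq b n) (+-cauchy {seq a} {seq b} (cauchy a) (cauchy b))

-ᴿ_ : ℝ → ℝ
-ᴿ a = mkℝ (λ n → ℚ.- seq a n) (neg-cauchy {seq a} (cauchy a))

_-ᴿ_ : ℝ → ℝ → ℝ
a -ᴿ b = a +ᴿ (-ᴿ b)

_*ᴿ_ : ℝ → ℝ → ℝ
a *ᴿ b = mkℝ (λ n → seq a n ℚ.* seq b n) (*-cauchy {seq a} {seq b} (cauchy a) (cauchy b))

_≤ᴿ_ : ℝ → ℝ → Set
a ≤ᴿ b = ∀ ε → 0ℚ ℚ.< ε → ∃[ N ] (∀ n → N ℕ.≤ n → seq a n ℚ.≤ seq b n ℚ.+ ε)

0ᴿ : ℝ
0ᴿ = fromℚ 0ℚ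

sumᴿ : List ℝ → ℝ
sumᴿ = foldr _+ᴿ_ 0ᴿ

record Graph : Set₁ where
  infix 4 _~_
  field
    V           : Set
    _~_         : Rel V 0ℓ
    ~-sym       : Symmetric _~_
    ~-irrefl    : Irreflexive _≡_ _~_
    nbrs        : V → List V
    nbrs-unique : ∀ u → Unique (nbrs u)
    ∈-nbrs      : ∀ {u v} → v ∈ nbrs u ⇔ u ~ v

  degree : V → ℕ
  degree u = length (nbrs u)

HasSize : Graph → ℕ → Set
HasSize G k = Graph.V G ↔ Fin k

Regular : Graph → ℕ → Set
Regular G d = ∀ u → Graph.degree G u ≡ d

module _ (G : Graph) where
  open Graph G

  Δ : (V → ℝ) → (V → ℝ)
  Δ f u = sumᴿ (map (λ v → f v -ᴿ f u) (nbrs u))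

  Γ : (V → ℝ) → (V → ℝ) → (V → ℝ)
  Γ f g u = fromℚ ½ *ᴿ (Δ (λ v → f v *ᴿ g v) u -ᴿ f u *ᴿ Δ g u -ᴿ g u *ᴿ Δ f u)

  Γ₂ : (V → ℝ) → (V → ℝ) → (V → ℝ)
  Γ₂ f g u = fromℚ ½ *ᴿ (Δ (Γ f g) u -ᴿ Γ f (Δ g) u -ᴿ Γ (Δ f) g u)

  CD[0,∞] : Set
  CD[0,∞] = ∀ (f : V → ℝ) (u : V) → 0ᴿ ≤ᴿ Γ₂ f f u

infixr 2 _□_

_□_ : Graph → Graph → Graph
G □ H = record
  { V           = G.V × H.V
  ; _~_         = _~_
  ; ~-sym       = λ { (inj₁ (refl , e)) → inj₁ (refl , H.~-sym e)
                    ; (inj₂ (e , refl)) → inj₂ (G.~-sym e , refl) }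
  ; ~-irrefl    = λ { refl (inj₁ (_ , e)) → H.~-irrefl refl e
                    ; refl (inj₂ (e , _)) → G.~-irrefl refl e }
  ; nbrs        = nbrs
  ; nbrs-unique = λ (u , v) →
      ++⁺ (map⁺ (cong proj₂) (H.nbrs-unique v)) (map⁺ (cong proj₁) (G.nbrs-unique u))
          (disjoint u v)
  ; ∈-nbrs      = mk⇔ to from
  }
  where
  module G = Graph G
  module H = Graph H

  _~_ : Rel (G.V × H.V) 0ℓ
  (u₁ , v₁) ~ (u₂ , v₂) = (u₁ ≡ u₂ × v₁ H.~ v₂) ⊎ (u₁ G.~ u₂ × v₁ ≡ v₂)

  nbrs : G.V × H.V → List (G.V × H.V)
  nbrs (u , v) = map (u ,_) (H.nbrs v) ++ map (_, v) (G.nbrs u)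

  disjoint : ∀ u v {p} → ¬ (p ∈ map (u ,_) (H.nbrs v) × p ∈ map (_, v) (G.nbrs u))
  disjoint u v (p∈ , p∈′) with ∈-map⁻ (u ,_) p∈ | ∈-map⁻ (_, v) p∈′
  ... | _ , _ , refl | _ , u∈ , refl = G.~-irrefl refl (Equivalence.to G.∈-nbrs u∈)

  to : ∀ {p q} → q ∈ nbrs p → p ~ q
  to {u , v} q∈ with ∈-++⁻ (map (u ,_) (H.nbrs v)) q∈
  ... | inj₁ q∈ˡ with ∈-map⁻ (u ,_) q∈ˡ
  ...   | _ , v∈ , refl = inj₁ (refl , Equivalence.to H.∈-nbrs v∈)
  to {u , v} q∈ | inj₂ q∈ʳ with ∈-map⁻ (_, v) q∈ʳ
  ...   | _ , u∈ , refl = inj₂ (Equivalence.to G.∈-nbrs u∈ , refl)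

  from : ∀ {p q} → p ~ q → q ∈ nbrs p
  from {u , v} (inj₁ (refl , e)) = ∈-++⁺ˡ (∈-map⁺ (u ,_) (Equivalence.from H.∈-nbrs e))
  from {u , v} (inj₂ (e , refl)) =
    ∈-++⁺ʳ (map (u ,_) (H.nbrs v)) (∈-map⁺ (_, v) (Equivalence.from G.∈-nbrs e))

module _ (n : ℕ) (3≤n : 3 ℕ.≤ n) where
  private instance
    n≢0 : NonZero n
    n≢0 = ℕ.>-nonZero (ℕ.≤-trans (s≤s z≤n) 3≤n)

  next prev : Fin n → Fin n
  next i = suc (toℕ i) mod n
  prev i = (toℕ i ℕ.+ ℕ.pred n) mod n

  CycleEdge : Rel (Fin n) 0ℓ
  CycleEdge i j = j ≡ next i

  toℕ-next : ∀ i → toℕ (next i) ≡ suc (toℕ i) % n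
  toℕ-next i = toℕ-fromℕ< (m%n<n (suc (toℕ i)) n)

  toℕ-prev : ∀ i → toℕ (prev i) ≡ (toℕ i ℕ.+ ℕ.pred n) % n
  toℕ-prev i = toℕ-fromℕ< (m%n<n (toℕ i ℕ.+ ℕ.pred n) n)

  next-cases : ∀ i → (toℕ (next i) ≡ suc (toℕ i)) ⊎ (suc (toℕ i) ≡ n × toℕ (next i) ≡ 0)
  next-cases i with ℕ.m≤n⇒m<n∨m≡n (toℕ<n i)
  ... | inj₁ i+1<n = inj₁ (trans (toℕ-next i) (m<n⇒m%n≡m i+1<n))
  ... | inj₂ i+1≡n = inj₂ (i+1≡n ,
    trans (toℕ-next i) (trans (cong (_% n) i+1≡n) (n%n≡0 n)))

  prev-next : ∀ i → prev (next i) ≡ i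
  prev-next i with next-cases i
  ... | inj₁ eq = toℕ-injective (begin
    toℕ (prev (next i))                ≡⟨ toℕ-prev (next i) ⟩
    (toℕ (next i) ℕ.+ ℕ.pred n) % n    ≡⟨ cong (λ k → (k ℕ.+ ℕ.pred n) % n) eq ⟩
    suc (toℕ i ℕ.+ ℕ.pred n) % n       ≡⟨ cong (_% n) (sym (ℕ.+-suc (toℕ i) (ℕ.pred n))) ⟩
    (toℕ i ℕ.+ suc (ℕ.pred n)) % n     ≡⟨ cong (λ k → (toℕ i ℕ.+ k) % n) (ℕ.suc-pred n) ⟩
    (toℕ i ℕ.+ n) % n                  ≡⟨ [m+n]%n≡m%n (toℕ i) n ⟩
    toℕ i % n                          ≡⟨ m<n⇒m%n≡m (toℕ<n i) ⟩
    toℕ i                              ∎)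
    where open ≡-Reasoning
  ... | inj₂ (i+1≡n , eq) = toℕ-injective (begin
    toℕ (prev (next i))                ≡⟨ toℕ-prev (next i) ⟩
    (toℕ (next i) ℕ.+ ℕ.pred n) % n    ≡⟨ cong (λ k → (k ℕ.+ ℕ.pred n) % n) eq ⟩
    ℕ.pred n % n                       ≡⟨ cong (_% n) (sym (cong ℕ.pred i+1≡n)) ⟩
    toℕ i % n                          ≡⟨ m<n⇒m%n≡m (toℕ<n i) ⟩
    toℕ i                              ∎)
    where open ≡-Reasoning

  next-prev : ∀ i → next (prev i) ≡ i
  next-prev i = toℕ-injective (trans (toℕ-next (prev i))
    (trans (cong (λ k → suc k % n) (toℕ-prev i)) (lemma (toℕ i) (toℕ<n i))))
    where
    open ≡-Reasoning
    lemma : ∀ k → k ℕ.< n → suc ((k ℕ.+ ℕ.pred n) % n) % n ≡ k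
    lemma zero _ = begin
      suc (ℕ.pred n % n) % n   ≡⟨ cong (λ l → suc l % n) (m<n⇒m%n≡m (ℕ.≤-reflexive (ℕ.suc-pred n))) ⟩
      suc (ℕ.pred n) % n       ≡⟨ cong (_% n) (ℕ.suc-pred n) ⟩
      n % n                    ≡⟨ n%n≡0 n ⟩
      0                        ∎
    lemma (suc k) k+1<n = begin
      suc ((suc k ℕ.+ ℕ.pred n) % n) % n
        ≡⟨ cong (λ l → suc (l % n) % n) (sym (ℕ.+-suc k (ℕ.pred n))) ⟩
      suc ((k ℕ.+ suc (ℕ.pred n)) % n) % n
        ≡⟨ cong (λ l → suc ((k ℕ.+ l) % n) % n) (ℕ.suc-pred n) ⟩
      suc ((k ℕ.+ n) % n) % n
        ≡⟨ cong (λ l → suc l % n)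
             (trans ([m+n]%n≡m%n k n) (m<n⇒m%n≡m (ℕ.<-trans (ℕ.n<1+n k) k+1<n))) ⟩
      suc k % n
        ≡⟨ m<n⇒m%n≡m k+1<n ⟩
      suc k ∎

  small : ∀ {k} → k ℕ.< 3 → k ≢ n
  small k<3 refl = ℕ.<⇒≱ k<3 3≤n

  next≢id : ∀ i → i ≢ next i
  next≢id i eq with next-cases i
  ... | inj₁ e = ℕ.m≢1+m+n (toℕ i) (trans (cong toℕ eq) (trans e (cong suc (sym (ℕ.+-identityʳ _)))))
  ... | inj₂ (i+1≡n , e) =
    small (s≤s (s≤s z≤n)) (trans (cong suc (sym (trans (cong toℕ eq) e))) i+1≡n)

  next²≢id : ∀ i → i ≢ next (next i)
  next²≢id i eq with next-cases i | next-cases (next i)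
  ... | inj₁ e | inj₁ e′ = ℕ.m≢1+m+n (toℕ i) {1}
    (trans (cong toℕ eq) (trans e′ (cong suc (trans e (ℕ.+-comm 1 (toℕ i))))))
  ... | inj₁ e | inj₂ (e₁ , e₂) = small (s≤s (s≤s (s≤s z≤n)))
    (trans (cong (suc ∘ suc) (sym (trans (cong toℕ eq) e₂))) (trans (cong suc (sym e)) e₁))
  ... | inj₂ (e₁ , e₂) | inj₁ e′ = small (s≤s (s≤s (s≤s z≤n)))
    (trans (cong suc (sym (trans (cong toℕ eq) (trans e′ (cong suc e₂))))) e₁)
  ... | inj₂ (e₁ , e₂) | inj₂ (e₁′ , e₂′) =
    small (s≤s (s≤s z≤n)) (trans (cong suc (sym e₂)) e₁′)

  Cycle : Graph
  Cycle = record
    { V           = Fin n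
    ; _~_         = SymClosure CycleEdge
    ; ~-sym       = symmetric CycleEdge
    ; ~-irrefl    = λ { refl (fwd e) → next≢id _ e ; refl (bwd e) → next≢id _ e }
    ; nbrs        = λ i → next i ∷ prev i ∷ []
    ; nbrs-unique = λ i → (next≢prev i ∷ []) ∷ [] ∷ []
    ; ∈-nbrs      = mk⇔ to from
    }
    where
    next≢prev : ∀ i → next i ≢ prev i
    next≢prev i eq = next²≢id i (sym (trans (cong next eq) (next-prev i)))

    to : ∀ {i j} → j ∈ next i ∷ prev i ∷ [] → SymClosure CycleEdge i j
    to (here refl)             = fwd refl
    to {i} (there (here refl)) = bwd (sym (next-prev i))

    from : ∀ {i j} → SymClosure CycleEdge i j → j ∈ next i ∷ prev i ∷ []
    from (fwd refl)     = here refl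
    from {j = j} (bwd refl) = there (here (sym (prev-next j)))

-- The graph G on seven vertices; x and y are indexed from 0, so x 0F is
-- x₁ and y 3F is y₄.

data V₇ : Set where
  x : Fin 3 → V₇
  y : Fin 4 → V₇

data Edge₇ : Rel V₇ 0ℓ where
  xy  : ∀ i j → Edge₇ (x i) (y j)
  y₁₂ : Edge₇ (y 0F) (y 1F)
  y₃₄ : Edge₇ (y 2F) (y 3F)

G₇ : Graph
G₇ = record
  { V           = V₇
  ; _~_         = SymClosure Edge₇
  ; ~-sym       = symmetric Edge₇
  ; ~-irrefl    = λ { refl (fwd ()) ; refl (bwd ()) }
  ; nbrs        = nbrs
  ; nbrs-unique = unique
  ; ∈-nbrs      = mk⇔ to from
  }
  where
  mate : Fin 4 → Fin 4
  mate 0F = 1F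
  mate 1F = 0F
  mate 2F = 3F
  mate 3F = 2F

  nbrs : V₇ → List V₇
  nbrs (x _) = y 0F ∷ y 1F ∷ y 2F ∷ y 3F ∷ []
  nbrs (y j) = y (mate j) ∷ x 0F ∷ x 1F ∷ x 2F ∷ []

  unique : ∀ u → Unique (nbrs u)
  unique (x _) = ((λ ()) ∷ (λ ()) ∷ (λ ()) ∷ []) ∷ ((λ ()) ∷ (λ ()) ∷ []) ∷ ((λ ()) ∷ []) ∷ [] ∷ []
  unique (y _) = ((λ ()) ∷ (λ ()) ∷ (λ ()) ∷ []) ∷ ((λ ()) ∷ (λ ()) ∷ []) ∷ ((λ ()) ∷ []) ∷ [] ∷ []

  mate-edge : ∀ j → SymClosure Edge₇ (y j) (y (mate j))
  mate-edge 0F = fwd y₁₂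
  mate-edge 1F = bwd y₁₂
  mate-edge 2F = fwd y₃₄
  mate-edge 3F = bwd y₃₄

  to : ∀ {u v} → v ∈ nbrs u → SymClosure Edge₇ u v
  to {x i} (here refl)                         = fwd (xy i 0F)
  to {x i} (there (here refl))                 = fwd (xy i 1F)
  to {x i} (there (there (here refl)))         = fwd (xy i 2F)
  to {x i} (there (there (there (here refl)))) = fwd (xy i 3F)
  to {y j} (here refl)                         = mate-edge j
  to {y j} (there (here refl))                 = bwd (xy 0F j)
  to {y j} (there (there (here refl)))         = bwd (xy 1F j)
  to {y j} (there (there (there (here refl)))) = bwd (xy 2F j)

  from : ∀ {u v} → SymClosure Edge₇ u v → v ∈ nbrs u
  from (fwd (xy i 0F)) = here refl
  from (fwd (xy i 1F)) = there (here refl)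
  from (fwd (xy i 2F)) = there (there (here refl))
  from (fwd (xy i 3F)) = there (there (there (here refl)))
  from (bwd (xy 0F j)) = there (here refl)
  from (bwd (xy 1F j)) = there (there (here refl))
  from (bwd (xy 2F j)) = there (there (there (here refl)))
  from (fwd y₁₂)       = here refl
  from (bwd y₁₂)       = here refl
  from (fwd y₃₄)       = here refl
  from (bwd y₃₄)       = here refl

G₇□C : (n : ℕ) → 3 ℕ.≤ n → Graph
G₇□C n 3≤n = G₇ □ Cycle n 3≤n

-- The vertices of the Cayley graph are the elements of H up to _≈_, and S
-- is the set of elements occurring in a list up to _≈_ (repetitions in the
-- list are immaterial).

module _ (H : Group 0ℓ 0ℓ) (S : List (Group.Carrier H)) where
  open Group H
  open SetoidMembership setoid using () renaming (_∈_ to _∈ˢ_)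

  data Generated : Carrier → Set where
    gen  : ∀ {g} → g ∈ˢ S → Generated g
    unit : Generated ε
    mul  : ∀ {g h} → Generated g → Generated h → Generated (g ∙ h)
    inv  : ∀ {g} → Generated g → Generated (g ⁻¹)
    resp : ∀ {g h} → g ≈ h → Generated g → Generated h

  record IsCayleySet : Set where
    field
      symmetricˢ : ∀ {s} → s ∈ˢ S → s ⁻¹ ∈ˢ S
      generating : ∀ g → Generated g
      ε∉S        : ¬ (ε ∈ˢ S)

  CayleyAdjacent : Rel Carrier 0ℓ
  CayleyAdjacent g h = ∃[ s ] (s ∈ˢ S × h ≈ g ∙ s)

-- The library's IsOrderIsomorphism makes no assumption on the relations
-- it compares: here it says that φ is a bijection preserving and
-- reflecting adjacency.
IsCayleyGraph : Graph → Set₁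
IsCayleyGraph G =
  Σ[ H ∈ Group 0ℓ 0ℓ ] Σ[ S ∈ List (Group.Carrier H) ] IsCayleySet H S ×
  ∃[ φ ] IsOrderIsomorphism (Group._≈_ H) (_≡_ {A = Graph.V G})
                            (CayleyAdjacent H S) (Graph._~_ G) φ

{-# OPTIONS --safe #-}

-- Curvature: every operation on the reals is pointwise on sequences, so it is
-- enough to show over ℚ that 4 Γ₂(f)(u) is nonnegative, where
--
--   4 Γ₂(f)(u) = Σ_{v ~ u} (E(v) − E(u) − 2 (f(v) − f(u)) (Δf(v) − Δf(u))),
--   E(v) = Σ_{w ~ v} (f(w) − f(v))².
--
-- On a Cartesian product this quantity is the sum of those of the two factors
-- and of the terms 2 e² with e = f(a,w) − f(a,v) − f(u,w) + f(u,v), for a ~ u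
-- and w ~ v.  On the factors it is an explicit sum of squares.
--
-- Cayley graphs are vertex transitive.  In Gₙ the edge from (y₁,v) to (y₂,v)
-- lies in the triangles with third vertices (x₁,v) and (x₂,v), whereas every
-- edge at a vertex (xᵢ,v) lies in at most one triangle.

module Submission where

open import Defs
open import Algebra.Bundles using (Group)
import Algebra.Properties.Group as GroupProperties
open import Data.Empty using (⊥-elim)
open import Data.Fin.Base using (Fin; fromℕ<)
open import Data.Fin.Patterns using (0F; 1F; 2F; 3F; 4F; 5F; 6F)
open import Data.Fin.Properties using (+↔⊎; *↔×)
import Data.Integer.Base as ℤ
open import Data.List.Base using (List; []; _∷_; _++_; map)
open import Data.List.Membership.Propositional using (_∈_)
open import Data.List.Relation.Unary.Any using (here; there)
open import Data.Nat.Base as ℕ using (ℕ; _≤_; _<_)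
import Data.Nat.Properties as ℕ
open import Data.Product.Base using (_×_; _,_; Σ-syntax; ∃-syntax; proj₁; proj₂)
open import Data.Product.Function.NonDependent.Propositional using (_×-↔_)
open import Data.Rational.Base as ℚ using (ℚ; 0ℚ; ½; _+_; _-_; _*_)
import Data.Rational.Properties as ℚ
open import Data.Rational.Solver using (module +-*-Solver)
open import Data.Sum.Base using (inj₁; inj₂)
open import Data.Vec.Base using (Vec; []; _∷_)
open import Function.Base using (_∘_; flip; _$_)
open import Function.Bundles using (_↔_; mk↔ₛ′; Equivalence)
open import Function.Construct.Composition using (_↔-∘_)
open import Function.Construct.Identity using (↔-id)
open import Function.Construct.Symmetry using (↔-sym)
open import Level using (0ℓ)
open import Relation.Binary.Construct.Closure.Symmetric using (SymClosure; fwd; bwd)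
open import Relation.Binary.Morphism.Structures using (IsOrderIsomorphism)
open import Relation.Binary.PropositionalEquality
  using (_≡_; _≢_; refl; sym; trans; cong; cong₂; subst; module ≡-Reasoning)
open import Relation.Nullary.Negation using (¬_)

open +-*-Solver using (Polynomial; var; con; _:+_; _:-_; _:*_; _:=_; ⟦_⟧; prove; solve)

-- The quadratic forms

-- The forms are needed both on rationals and on the solver's polynomials, so
-- that a polynomial copy of a form evaluates to the form definitionally.
module Forms {A : Set} (_⊕_ _⊖_ _⊛_ : A → A → A) (𝟘 : A) where

  ∑ : {I : Set} → List I → (I → A) → A
  ∑ []       g = 𝟘
  ∑ (i ∷ is) g = g i ⊕ ∑ is g

  module _ {V : Set} (nbrs : V → List V) where

    laplacian : (V → A) → V → A
    laplacian f u = ∑ (nbrs u) λ v → f v ⊖ f u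

    -- 2 Γ(f,g)
    carré : (V → A) → (V → A) → V → A
    carré f g u = ∑ (nbrs u) λ v → (f v ⊖ f u) ⊛ (g v ⊖ g u)

    -- `t` is subtracted twice because the carrier offers no numeral 2.
    curvatureTerm : (V → A) → V → V → A
    curvatureTerm f u v = ((carré f f v ⊖ carré f f u) ⊖ t) ⊖ t
      where t = (f v ⊖ f u) ⊛ (laplacian f v ⊖ laplacian f u)

    -- 4 Γ₂(f)
    curvature : (V → A) → V → A
    curvature f u = ∑ (nbrs u) (curvatureTerm f u)

open Forms _+_ _-_ _*_ 0ℚ
module Poly {n} = Forms {Polynomial n} _:+_ _:-_ _:*_ (con 0ℚ)

-- Finite sums of rationals

private variable
  I J : Set

∑-cong : ∀ (is : List I) {g h} → (∀ i → g i ≡ h i) → ∑ is g ≡ ∑ is h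
∑-cong []       eq = refl
∑-cong (i ∷ is) eq = cong₂ _+_ (eq i) (∑-cong is eq)

∑-0 : ∀ (is : List I) → ∑ is (λ _ → 0ℚ) ≡ 0ℚ
∑-0 []       = refl
∑-0 (i ∷ is) = trans (ℚ.+-identityˡ _) (∑-0 is)

∑-+ : ∀ (is : List I) g h → ∑ is (λ i → g i + h i) ≡ ∑ is g + ∑ is h
∑-+ []       g h = refl
∑-+ (i ∷ is) g h = trans (cong (g i + h i +_) (∑-+ is g h))
  (solve 4 (λ a b c d → (a :+ b) :+ (c :+ d) := (a :+ c) :+ (b :+ d)) refl
    (g i) (h i) (∑ is g) (∑ is h))

∑-*ˡ : ∀ c (is : List I) g → ∑ is (λ i → c * g i) ≡ c * ∑ is g
∑-*ˡ c []       g = sym (ℚ.*-zeroʳ c)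
∑-*ˡ c (i ∷ is) g =
  trans (cong (c * g i +_) (∑-*ˡ c is g)) (sym (ℚ.*-distribˡ-+ c (g i) (∑ is g)))

∑-- : ∀ (is : List I) g h → ∑ is (λ i → g i - h i) ≡ ∑ is g - ∑ is h
∑-- []       g h = refl
∑-- (i ∷ is) g h = trans (cong (g i - h i +_) (∑-- is g h))
  (solve 4 (λ a b c d → (a :- b) :+ (c :- d) := (a :+ c) :- (b :+ d)) refl
    (g i) (h i) (∑ is g) (∑ is h))

∑-linear : ∀ (is : List I) f c g d h →
  ∑ is (λ i → f i - c * g i - d * h i) ≡ ∑ is f - c * ∑ is g - d * ∑ is h
∑-linear is f c g d h = trans (∑-- is _ _)
  (cong₂ _-_ (trans (∑-- is _ _) (cong (∑ is f -_) (∑-*ˡ c is g))) (∑-*ˡ d is h))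

∑-++ : ∀ (is js : List I) g → ∑ (is ++ js) g ≡ ∑ is g + ∑ js g
∑-++ []       js g = sym (ℚ.+-identityˡ _)
∑-++ (i ∷ is) js g = trans (cong (g i +_) (∑-++ is js g)) (sym (ℚ.+-assoc (g i) _ _))

∑-map : ∀ (φ : J → I) js g → ∑ (map φ js) g ≡ ∑ js (g ∘ φ)
∑-map φ []       g = refl
∑-map φ (j ∷ js) g = cong (g (φ j) +_) (∑-map φ js g)

∑-swap : ∀ (is : List I) (js : List J) g →
  ∑ is (λ i → ∑ js (g i)) ≡ ∑ js (λ j → ∑ is (flip g j))
∑-swap []       js g = sym (∑-0 js)
∑-swap (i ∷ is) js g = trans (cong (∑ js (g i) +_) (∑-swap is js g)) (sym (∑-+ js _ _))

-- Nonnegativity and sums of squares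

0≤+ : ∀ {p q} → 0ℚ ℚ.≤ p → 0ℚ ℚ.≤ q → 0ℚ ℚ.≤ p + q
0≤+ = ℚ.+-mono-≤

0≤∑ : ∀ (is : List I) {g} → (∀ i → 0ℚ ℚ.≤ g i) → 0ℚ ℚ.≤ ∑ is g
0≤∑ []       0≤g = ℚ.≤-refl
0≤∑ (i ∷ is) 0≤g = 0≤+ (0≤g i) (0≤∑ is 0≤g)

0≤* : ∀ {p q} → 0ℚ ℚ.≤ p → 0ℚ ℚ.≤ q → 0ℚ ℚ.≤ p * q
0≤* {p} {q} 0≤p 0≤q =
  subst (ℚ._≤ p * q) (ℚ.*-zeroʳ p) (ℚ.*-monoˡ-≤-nonNeg p {{ℚ.nonNegative 0≤p}} 0≤q)

0≤square : ∀ p → 0ℚ ℚ.≤ p * p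
0≤square p with ℚ.≤-total 0ℚ p
... | inj₁ 0≤p = 0≤* 0≤p 0≤p
... | inj₂ p≤0 = ℚ.nonNegative⁻¹ _ {{ℚ.nonPos*nonPos⇒nonPos p {{np}} p {{np}}}}
  where np = ℚ.nonPositive p≤0

fromℕ : ℕ → ℚ
fromℕ n = ℤ.+ n ℚ./ 1

module _ {n : ℕ} where

  const : ℕ → Polynomial n
  const c = con (fromℕ c)

  -- Natural-number weights make nonnegativity immediate, so a curvature bound reduces to one
  -- polynomial identity that the solver checks.
  sumOfSquares : List (ℕ × Polynomial n) → Polynomial n
  sumOfSquares ls = Poly.∑ ls λ (c , l) → const c :* (l :* l)

  0≤sumOfSquares : ∀ ls (ρ : Vec ℚ n) → 0ℚ ℚ.≤ ⟦ sumOfSquares ls ⟧ ρ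
  0≤sumOfSquares []             ρ = ℚ.≤-refl
  0≤sumOfSquares ((c , l) ∷ ls) ρ = 0≤+
    (0≤* (ℚ.nonNegative⁻¹ (fromℕ c) {{ℚ.normalize-nonNeg c 1}}) (0≤square (⟦ l ⟧ ρ)))
    (0≤sumOfSquares ls ρ)

-- Curvature over ℝ and over ℚ

module _ (G : Graph) (k : ℕ) where
  open Graph G

  at : (V → ℝ) → V → ℚ
  at f v = seq (f v) k

  seq-sum : ∀ (vs : List V) g → seq (sumᴿ (map g vs)) k ≡ ∑ vs (at g)
  seq-sum []       g = refl
  seq-sum (v ∷ vs) g = cong (at g v +_) (seq-sum vs g)

  seq-Δ : ∀ f u → at (Δ G f) u ≡ laplacian nbrs (at f) u
  seq-Δ f u = seq-sum (nbrs u) (λ v → f v -ᴿ f u)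

  -- Neighbour by neighbour, the summand of `Δ(fg) − fΔg − gΔf` factors into the two differences of
  -- `f` and `g`.
  seq-Γ : ∀ f g u → at (Γ G f g) u ≡ ½ * carré nbrs (at f) (at g) u
  seq-Γ f g u = cong (½ *_) $ begin
    at (Δ G λ v → f v *ᴿ g v) u - at f u * at (Δ G g) u - at g u * at (Δ G f) u
      ≡⟨ cong₂ _-_ (cong₂ (λ a b → a - at f u * b) (seq-Δ (λ v → f v *ᴿ g v) u) (seq-Δ g u))
                   (cong (at g u *_) (seq-Δ f u)) ⟩
    laplacian nbrs (λ v → at f v * at g v) u
      - at f u * laplacian nbrs (at g) u - at g u * laplacian nbrs (at f) u
      ≡⟨ ∑-linear (nbrs u) _ (at f u) _ (at g u) _ ⟨
    ∑ (nbrs u) (λ v → (at f v * at g v - at f u * at g u)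
      - at f u * (at g v - at g u) - at g u * (at f v - at f u))
      ≡⟨ ∑-cong (nbrs u) (λ v → solve 4 (λ a b c d →
           (a :* b :- c :* d) :- c :* (b :- d) :- d :* (a :- c) := (a :- c) :* (b :- d))
           refl (at f v) (at g v) (at f u) (at g u)) ⟩
    carré nbrs (at f) (at g) u ∎
    where open ≡-Reasoning

  seq-Γ₂ : ∀ f u → at (Γ₂ G f f) u ≡ ½ * (½ * curvature nbrs (at f) u)
  seq-Γ₂ f u = cong (½ *_) $ begin
    at (Δ G (Γ G f f)) u - at (Γ G f (Δ G f)) u - at (Γ G (Δ G f) f) u
      ≡⟨ cong₂ _-_ (cong₂ _-_
           (trans (seq-Δ (Γ G f f) u) (∑-cong (nbrs u) λ v → cong₂ _-_ (seq-Γ f f v) (seq-Γ f f u)))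
           (trans (seq-Γ f (Δ G f) u) (cong (½ *_) (∑-cong (nbrs u) λ v →
             cong (d v *_) (cong₂ _-_ (seq-Δ f v) (seq-Δ f u))))))
           -- By commutativity `Γ(Δf,f)` gives the same sum as `Γ(f,Δf)`, hence two copies of `t`.
           (trans (seq-Γ (Δ G f) f u) (cong (½ *_) (∑-cong (nbrs u) λ v →
             trans (cong (_* d v) (cong₂ _-_ (seq-Δ f v) (seq-Δ f u)))
                   (ℚ.*-comm _ (d v))))) ⟩
    ∑ (nbrs u) (λ v → ½ * E v - ½ * E u) - ½ * ∑ (nbrs u) t - ½ * ∑ (nbrs u) t
      ≡⟨ ∑-linear (nbrs u) _ ½ t ½ t ⟨
    ∑ (nbrs u) (λ v → (½ * E v - ½ * E u) - ½ * t v - ½ * t v)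
      ≡⟨ ∑-cong (nbrs u) (λ v → solve 3 (λ a b c →
           (con ½ :* a :- con ½ :* b) :- con ½ :* c :- con ½ :* c
             := con ½ :* ((a :- b) :- c :- c))
           refl (E v) (E u) (t v)) ⟩
    ∑ (nbrs u) (λ v → ½ * curvatureTerm nbrs (at f) u v)
      ≡⟨ ∑-*ˡ ½ (nbrs u) _ ⟩
    ½ * curvature nbrs (at f) u ∎
    where
    open ≡-Reasoning
    d t E : V → ℚ
    d v = at f v - at f u
    t v = d v * (laplacian nbrs (at f) v - laplacian nbrs (at f) u)
    E = carré nbrs (at f) (at f)

CDℚ : Graph → Set
CDℚ G = ∀ f u → 0ℚ ℚ.≤ curvature (Graph.nbrs G) f u

CDℚ⇒CD : ∀ G → CDℚ G → CD[0,∞] G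
-- The bound holds for every term of the sequence, not only in the limit, so the threshold is 0 for
-- each `ε`.
CDℚ⇒CD G cd f u ε ε>0 = 0 , λ k _ → 0≤+
  (subst (0ℚ ℚ.≤_) (sym (seq-Γ₂ G k f u)) (0≤* 0≤½ (0≤* 0≤½ (cd (at G k f) u))))
  (ℚ.<⇒≤ ε>0)
  where
  0≤½ : 0ℚ ℚ.≤ ½
  0≤½ = ℚ.nonNegative⁻¹ ½

-- Cartesian products

module _ (G H : Graph) where
  private
    module G = Graph G
    module H = Graph H
    N = Graph.nbrs (G □ H)

  ∑-□ : ∀ a b g →
    ∑ (N (a , b)) g ≡ ∑ (H.nbrs b) (λ w → g (a , w)) + ∑ (G.nbrs a) (λ c → g (c , b))
  ∑-□ a b g = trans (∑-++ (map (a ,_) (H.nbrs b)) _ g)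
    (cong₂ _+_ (∑-map (a ,_) (H.nbrs b) g) (∑-map (_, b) (G.nbrs a) g))

  module _ (f : G.V × H.V → ℚ) (u : G.V) (v : H.V) where
    -- The second difference of `f` around the four-cycle spanned by `u ~ a` and `v ~ w`.
    mixed : H.V → G.V → ℚ
    mixed w a = f (a , w) - f (a , v) - f (u , w) + f (u , v)

    private
      row : G.V → H.V → ℚ
      row a w = f (a , w)
      column : H.V → G.V → ℚ
      column w a = f (a , w)

      -- Both `carré` and `laplacian` add over the two factors of the product, so a curvature term
      -- splits into these two parts.
      partᴴ partᴳ : G.V → H.V → ℚ
      partᴴ a w =
        ((carré H.nbrs (row a) (row a) w - carré H.nbrs (row u) (row u) v) - t) - t
        where
        t = (f (a , w) - f (u , v)) * (laplacian H.nbrs (row a) w - laplacian H.nbrs (row u) v)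
      partᴳ a w =
        ((carré G.nbrs (column w) (column w) a - carré G.nbrs (column v) (column v) u) - t) - t
        where
        t = (f (a , w) - f (u , v)) * (laplacian G.nbrs (column w) a - laplacian G.nbrs (column v) u)

      -- Contributions of a single four-cycle: `crossᴳ w a` is the share of the neighbour `a` in
      -- `partᴳ u w`, and `crossᴴ w a` that of `w` in `partᴴ a v`.
      crossᴴ crossᴳ : H.V → G.V → ℚ
      crossᴴ w a = ((row a w - row a v) * (row a w - row a v)
                     - (row u w - row u v) * (row u w - row u v)) - t - t
        where t = (row a v - row u v) * ((row a w - row a v) - (row u w - row u v))
      crossᴳ w a = ((column w a - column w u) * (column w a - column w u)
                     - (column v a - column v u) * (column v a - column v u)) - t - t
        where t = (column w u - column v u)
                    * ((column w a - column w u) - (column v a - column v u))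

      -- Each cross term is a multiple of the mixed difference and may be negative alone; the two
      -- cofactors add up to twice that difference.
      cross≡mixed : ∀ w a → crossᴳ w a + crossᴴ w a ≡ mixed w a * mixed w a + mixed w a * mixed w a
      cross≡mixed w a = solve 4 (λ p q r s →
        let t₁ = (q :- s) :* ((p :- q) :- (r :- s))
            t₂ = (r :- s) :* ((p :- r) :- (q :- s))
            e  = p :- r :- q :+ s
        in ((((p :- q) :* (p :- q) :- (r :- s) :* (r :- s)) :- t₁) :- t₁)
             :+ ((((p :- r) :* (p :- r) :- (q :- s) :* (q :- s)) :- t₂) :- t₂)
             := e :* e :+ e :* e)
        refl (f (a , w)) (f (u , w)) (f (a , v)) (f (u , v))

      split : ∀ a w → curvatureTerm N f (u , v) (a , w) ≡ partᴴ a w + partᴳ a w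
      split a w = trans
        (cong₂ (λ c t → (c - t) - t)
          (cong₂ _-_ (∑-□ a w _) (∑-□ u v _))
          (cong ((f (a , w) - f (u , v)) *_) (cong₂ _-_ (∑-□ a w _) (∑-□ u v _))))
        (solve 9 (λ d c₁ c₂ c₁′ c₂′ l₁ l₂ l₁′ l₂′ →
          let t  = d :* ((l₁ :+ l₂) :- (l₁′ :+ l₂′))
              t₁ = d :* (l₁ :- l₁′)
              t₂ = d :* (l₂ :- l₂′)
          in (((c₁ :+ c₂) :- (c₁′ :+ c₂′)) :- t) :- t
               := (((c₁ :- c₁′) :- t₁) :- t₁) :+ (((c₂ :- c₂′) :- t₂) :- t₂))
          refl (f (a , w) - f (u , v))
          (carré H.nbrs (row a) (row a) w) (carré G.nbrs (column w) (column w) a)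
          (carré H.nbrs (row u) (row u) v) (carré G.nbrs (column v) (column v) u)
          (laplacian H.nbrs (row a) w) (laplacian G.nbrs (column w) a)
          (laplacian H.nbrs (row u) v) (laplacian G.nbrs (column v) u))

      ∑-term : ∀ (is : List I) d c c′ l l′ →
        ∑ is (λ i → ((c i - c′ i) - d * (l i - l′ i)) - d * (l i - l′ i))
          ≡ ((∑ is c - ∑ is c′) - d * (∑ is l - ∑ is l′)) - d * (∑ is l - ∑ is l′)
      ∑-term is d c c′ l l′ = trans (∑-linear is _ d _ d _)
        (cong₂ (λ a b → a - d * b - d * b) (∑-- is c c′) (∑-- is l l′))

      -- The first coordinate stays `u`, so `partᴴ u w` is a curvature term of `H`. The factor
      -- `f (u , w) - f (u , v)` is constant in the sum over `G.nbrs u`, so `partᴳ u w` becomes a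
      -- sum of cross terms.
      along-H : ∀ w → curvatureTerm N f (u , v) (u , w)
        ≡ curvatureTerm H.nbrs (row u) v w + ∑ (G.nbrs u) (crossᴳ w)
      along-H w = trans (split u w)
        (cong (partᴴ u w +_) (sym (∑-term (G.nbrs u) (f (u , w) - f (u , v)) _ _ _ _)))

      along-G : ∀ a → curvatureTerm N f (u , v) (a , v)
        ≡ ∑ (H.nbrs v) (λ w → crossᴴ w a) + curvatureTerm G.nbrs (column v) u a
      along-G a = trans (split a v)
        (cong (_+ partᴳ a v) (sym (∑-term (H.nbrs v) (f (a , v) - f (u , v)) _ _ _ _)))

    curvature-□ : curvature N f (u , v) ≡
      curvature H.nbrs (row u) v + curvature G.nbrs (column v) u
        + ∑ (H.nbrs v) (λ w → ∑ (G.nbrs u) λ a → mixed w a * mixed w a + mixed w a * mixed w a)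
    curvature-□ = begin
      curvature N f (u , v)
        ≡⟨ ∑-□ u v _ ⟩
      ∑ (H.nbrs v) (λ w → curvatureTerm N f (u , v) (u , w))
        + ∑ (G.nbrs u) (λ a → curvatureTerm N f (u , v) (a , v))
        ≡⟨ cong₂ _+_ (trans (∑-cong (H.nbrs v) along-H) (∑-+ (H.nbrs v) _ _))
                     (trans (∑-cong (G.nbrs u) along-G) (∑-+ (G.nbrs u) _ _)) ⟩
      (κᴴ + X) + (∑ (G.nbrs u) (λ a → ∑ (H.nbrs v) λ w → crossᴴ w a) + κᴳ)
        -- After the swap both double sums run over the same four-cycles in the same order and can
        -- be added termwise.
        ≡⟨ cong (λ s → (κᴴ + X) + (s + κᴳ)) (∑-swap (G.nbrs u) (H.nbrs v) _) ⟩
      (κᴴ + X) + (Y + κᴳ)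
        ≡⟨ solve 4 (λ a b c d → (a :+ b) :+ (c :+ d) := (a :+ d) :+ (b :+ c)) refl κᴴ X Y κᴳ ⟩
      (κᴴ + κᴳ) + (X + Y)
        ≡⟨ cong (κᴴ + κᴳ +_) (trans (sym (∑-+ (H.nbrs v) _ _))
             (∑-cong (H.nbrs v) λ w → trans (sym (∑-+ (G.nbrs u) _ _))
               (∑-cong (G.nbrs u) (cross≡mixed w)))) ⟩
      κᴴ + κᴳ + ∑ (H.nbrs v) (λ w → ∑ (G.nbrs u) λ a → mixed w a * mixed w a + mixed w a * mixed w a) ∎
      where
      open ≡-Reasoning
      κᴴ κᴳ X Y : ℚ
      κᴴ = curvature H.nbrs (row u) v
      κᴳ = curvature G.nbrs (column v) u
      X  = ∑ (H.nbrs v) λ w → ∑ (G.nbrs u) (crossᴳ w)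
      Y  = ∑ (H.nbrs v) λ w → ∑ (G.nbrs u) (crossᴴ w)

  CDℚ-□ : CDℚ G → CDℚ H → CDℚ (G □ H)
  CDℚ-□ cdG cdH f (u , v) = subst (0ℚ ℚ.≤_) (sym (curvature-□ f u v))
    (0≤+ (0≤+ (cdH (λ w → f (u , w)) v) (cdG (λ a → f (a , v)) u))
      (0≤∑ (H.nbrs v) λ w → 0≤∑ (G.nbrs u) λ a →
        0≤+ (0≤square (mixed f u v w a)) (0≤square (mixed f u v w a))))

-- Cycles and G₇

module _ {V : Set} (succ pred : V → V)
  (pred-succ : ∀ i → pred (succ i) ≡ i) (succ-pred : ∀ i → succ (pred i) ≡ i) where

  private
    -- The window around `i`, numbered as in `ρ`. Curvature at 0 never looks at the neighbours of 3
    -- and 4. As the variables are independent, vertices that coincide on short cycles do no harm.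
    path : Fin 5 → List (Fin 5)
    path 0F = 1F ∷ 2F ∷ []
    path 1F = 3F ∷ 0F ∷ []
    path 2F = 0F ∷ 4F ∷ []
    path _  = []

    -- The three forms are the Laplacians of `f` at `succ i`, `pred i` and `i`.
    squares : List (ℕ × Polynomial 5)
    squares =
      (1 , var 3F :- var 0F :- const 2 :* (var 1F :- var 0F)) ∷
      (1 , var 4F :- var 0F :- const 2 :* (var 2F :- var 0F)) ∷
      (2 , (var 1F :- var 0F) :+ (var 2F :- var 0F)) ∷ []

  0≤curvature-orbit : ∀ f i → 0ℚ ℚ.≤ curvature (λ j → succ j ∷ pred j ∷ []) f i
  0≤curvature-orbit f i rewrite pred-succ i | succ-pred i =
    subst (0ℚ ℚ.≤_) (sym (prove ρ (Poly.curvature path var 0F) (sumOfSquares squares) refl))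
      (0≤sumOfSquares squares ρ)
    where
    ρ : Vec ℚ 5
    ρ = f i ∷ f (succ i) ∷ f (pred i) ∷ f (succ (succ i)) ∷ f (pred (pred i)) ∷ []

CDℚ-Cycle : ∀ n 3≤n → CDℚ (Cycle n 3≤n)
CDℚ-Cycle n 3≤n =
  0≤curvature-orbit (next n 3≤n) (prev n 3≤n) (prev-next n 3≤n) (next-prev n 3≤n)

module G₇-Curvature where

  index : V₇ → Fin 7
  index (x 0F) = 0F
  index (x 1F) = 1F
  index (x 2F) = 2F
  index (y 0F) = 3F
  index (y 1F) = 4F
  index (y 2F) = 5F
  index (y 3F) = 6F

  values : (V₇ → ℚ) → Vec ℚ 7
  values f =
    f (x 0F) ∷ f (x 1F) ∷ f (x 2F) ∷ f (y 0F) ∷ f (y 1F) ∷ f (y 2F) ∷ f (y 3F) ∷ []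

  value : V₇ → Polynomial 7
  value = var ∘ index

  others : Fin 3 → Fin 3 × Fin 3
  others 0F = 1F , 2F
  others 1F = 0F , 2F
  others 2F = 0F , 1F

  partition : Fin 4 → Fin 4 × Fin 4 × Fin 4
  partition 0F = 1F , 2F , 3F
  partition 1F = 0F , 2F , 3F
  partition 2F = 3F , 0F , 1F
  partition 3F = 2F , 0F , 1F

  -- Weighted linear forms whose squares sum to 12 Γ₂(f)(u).  With f(u) = 0 this is
  --   12(a₁−a₂)² + 12(a₃−a₄)² + 15 Σ aⱼ² + 3(2b−A)² + 3(2c−A)²
  -- at xᵢ, where aⱼ are the values at the y's, A = Σ aⱼ, and b, c are the
  -- values at the other x's; and
  --   (3p−2B)² + (3q−2B)² + (B−6m)² + 3m² + 3 Σ_{i<j} (bᵢ−bⱼ)² + 18 Σ bᵢ²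
  -- at yⱼ, where bᵢ are the values at the x's, B = Σ bᵢ, m is the value at the
  -- adjacent y, and p, q are the values at the two other y's.
  squares : V₇ → List (ℕ × Polynomial 7)
  squares (x i) = let (j , k) = others i in
    (12 , a 0F :- a 1F) ∷ (12 , a 2F :- a 3F) ∷
    (15 , a 0F) ∷ (15 , a 1F) ∷ (15 , a 2F) ∷ (15 , a 3F) ∷
    (3 , const 2 :* b j :- A) ∷ (3 , const 2 :* b k :- A) ∷ []
    where
    a : Fin 4 → Polynomial 7
    a j = value (y j) :- value (x i)
    b : Fin 3 → Polynomial 7
    b j = value (x j) :- value (x i)
    A : Polynomial 7
    A = a 0F :+ a 1F :+ a 2F :+ a 3F
  squares (y j) = let (m , p , q) = partition j in
    (1 , const 3 :* a p :- const 2 :* B) ∷ (1 , const 3 :* a q :- const 2 :* B) ∷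
    (1 , B :- const 6 :* a m) ∷ (3 , a m) ∷
    (3 , b 0F :- b 1F) ∷ (3 , b 0F :- b 2F) ∷ (3 , b 1F :- b 2F) ∷
    (18 , b 0F) ∷ (18 , b 1F) ∷ (18 , b 2F) ∷ []
    where
    a : Fin 4 → Polynomial 7
    a i = value (y i) :- value (y j)
    b : Fin 3 → Polynomial 7
    b i = value (x i) :- value (y j)
    B : Polynomial 7
    B = b 0F :+ b 1F :+ b 2F

  open Graph G₇

  -- The factor 3 clears the thirds that arise from completing squares at the `y j`.
  form : V₇ → Polynomial 7
  form u = const 3 :* Poly.curvature nbrs value u

  -- The vertices are listed one by one because `nbrs` and `index` compute only on concrete indices.
  form≡squares : ∀ f u → fromℕ 3 * curvature nbrs f u ≡ ⟦ sumOfSquares (squares u) ⟧ (values f)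
  form≡squares f u@(x 0F) = prove (values f) (form u) (sumOfSquares (squares u)) refl
  form≡squares f u@(x 1F) = prove (values f) (form u) (sumOfSquares (squares u)) refl
  form≡squares f u@(x 2F) = prove (values f) (form u) (sumOfSquares (squares u)) refl
  form≡squares f u@(y 0F) = prove (values f) (form u) (sumOfSquares (squares u)) refl
  form≡squares f u@(y 1F) = prove (values f) (form u) (sumOfSquares (squares u)) refl
  form≡squares f u@(y 2F) = prove (values f) (form u) (sumOfSquares (squares u)) refl
  form≡squares f u@(y 3F) = prove (values f) (form u) (sumOfSquares (squares u)) refl

CDℚ-G₇ : CDℚ G₇
CDℚ-G₇ f u = ℚ.*-cancelˡ-≤-pos (fromℕ 3)
  (subst (0ℚ ℚ.≤_) (sym (form≡squares f u)) (0≤sumOfSquares (squares u) (values f)))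
  where open G₇-Curvature

-- Not a Cayley graph

EdgeInTwoTriangles : (G : Graph) → Graph.V G → Set
EdgeInTwoTriangles G u = ∃[ a ] ∃[ b ] ∃[ c ]
  (u ~ a × b ≢ c × (u ~ b × a ~ b) × (u ~ c × a ~ c))
  where open Graph G

module _ (H : Group 0ℓ 0ℓ) (S : List (Group.Carrier H)) where
  open Group H

  -- Adjacency multiplies by generators on the right, so associativity lets left multiplication pass
  -- through.
  translate : ∀ t {g h} → CayleyAdjacent H S g h → CayleyAdjacent H S (t ∙ g) (t ∙ h)
  translate t {g} (s , s∈S , h≈gs) =
    s , s∈S , Group.trans H (∙-congˡ h≈gs) (Group.sym H (assoc t g s))

cayley-homogeneous : ∀ G → IsCayleyGraph G →
  ∀ u v → EdgeInTwoTriangles G u → EdgeInTwoTriangles G v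
cayley-homogeneous G (H , S , _ , φ , iso) u v
  (a , b , c , u~a , b≢c , (u~b , a~b) , (u~c , a~c)) =
  move a , move b , move c , from-u u~a , b≢c ∘ move-injective ,
  (from-u u~b , move-~ a~b) , (from-u u~c , move-~ a~c)
  where
  open Graph G
  open Group H hiding (refl; sym; trans)
  open GroupProperties H using (∙-cancelˡ)
  open IsOrderIsomorphism iso renaming (cong to φ-cong)

  φ⁻¹ : V → Carrier
  φ⁻¹ w = proj₁ (surjective w)

  φ-φ⁻¹ : ∀ w → φ (φ⁻¹ w) ≡ w
  φ-φ⁻¹ w = proj₂ (surjective w) (Group.refl H)

  -- The quotient of the elements at `v` and `u`: left translation by it takes `u` to `v`.
  t : Carrier
  t = φ⁻¹ v ∙ φ⁻¹ u ⁻¹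

  move : V → V
  move w = φ (t ∙ φ⁻¹ w)

  move-u : move u ≡ v
  move-u = trans (φ-cong t∙u≈v) (φ-φ⁻¹ v)
    where
    t∙u≈v : t ∙ φ⁻¹ u ≈ φ⁻¹ v
    t∙u≈v = Group.trans H (assoc _ _ _)
      (Group.trans H (∙-congˡ (inverseˡ _)) (identityʳ _))

  move-~ : ∀ {p q} → p ~ q → move p ~ move q
  move-~ {p} {q} p~q = mono (translate H S t (cancel
    (subst (_~ φ (φ⁻¹ q)) (sym (φ-φ⁻¹ p)) (subst (p ~_) (sym (φ-φ⁻¹ q)) p~q))))

  from-u : ∀ {p} → u ~ p → v ~ move p
  from-u {p} u~p = subst (_~ move p) move-u (move-~ u~p)

  move-injective : ∀ {p q} → move p ≡ move q → p ≡ q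
  move-injective {p} {q} eq = trans (sym (φ-φ⁻¹ p))
    (trans (φ-cong (∙-cancelˡ t _ _ (injective eq))) (φ-φ⁻¹ q))

-- The edges among the `y`'s form a perfect matching.
mate-unique : ∀ {j k l} → SymClosure Edge₇ (y j) (y k) → SymClosure Edge₇ (y j) (y l) → k ≡ l
mate-unique (fwd y₁₂) (fwd y₁₂) = refl
mate-unique (fwd y₃₄) (fwd y₃₄) = refl
mate-unique (bwd y₁₂) (bwd y₁₂) = refl
mate-unique (bwd y₃₄) (bwd y₃₄) = refl

pair-unique : ∀ {A : Set} {p q a b c : A} → a ∈ p ∷ q ∷ [] → b ∈ p ∷ q ∷ [] → c ∈ p ∷ q ∷ [] →
  a ≢ b → a ≢ c → b ≡ c
pair-unique _ (here refl) (here refl) _ _ = refl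
pair-unique _ (there (here refl)) (there (here refl)) _ _ = refl
pair-unique (here refl) (here refl) _ a≢b _ = ⊥-elim (a≢b refl)
pair-unique (here refl) _ (here refl) _ a≢c = ⊥-elim (a≢c refl)
pair-unique (there (here refl)) (there (here refl)) _ a≢b _ = ⊥-elim (a≢b refl)
pair-unique (there (here refl)) _ (there (here refl)) _ a≢c = ⊥-elim (a≢c refl)

module _ (n : ℕ) (3≤n : 3 ≤ n) where
  private
    C = Cycle n 3≤n
    module C = Graph C
  open Graph (G₇□C n 3≤n)

  edgeInTwoTriangles-y : ∀ v → EdgeInTwoTriangles (G₇□C n 3≤n) (y 0F , v)
  edgeInTwoTriangles-y v = (y 1F , v) , (x 0F , v) , (x 1F , v) ,
    inj₂ (fwd y₁₂ , refl) , (λ ()) ,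
    (inj₂ (bwd (xy 0F 0F) , refl) , inj₂ (bwd (xy 0F 1F) , refl)) ,
    (inj₂ (bwd (xy 1F 0F) , refl) , inj₂ (bwd (xy 1F 1F) , refl))

  -- Leaving the copy of `G₇` over `v` for the third vertex would force a loop in the cycle.
  triangle-x-y : ∀ {i j v b} → (x i , v) ~ b → (y j , v) ~ b →
    ∃[ k ] (b ≡ (y k , v) × SymClosure Edge₇ (y j) (y k))
  triangle-x-y (inj₁ (refl , v~w)) (inj₂ (_ , refl)) = ⊥-elim (C.~-irrefl refl v~w)
  triangle-x-y (inj₂ (fwd (xy _ k) , refl)) (inj₁ (_ , v~v)) = ⊥-elim (C.~-irrefl refl v~v)
  triangle-x-y (inj₂ (fwd (xy _ k) , refl)) (inj₂ (e , _)) = k , refl , e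

  -- No two `x`'s are adjacent, and a `y` over `v` is not adjacent to an `x` over `w`, so the
  -- triangle lies in the copy of the cycle at `x i`.
  triangle-x-x : ∀ {i v w b} → v C.~ w → (x i , v) ~ b → (x i , w) ~ b →
    ∃[ w′ ] (b ≡ (x i , w′) × v C.~ w′ × w C.~ w′)
  triangle-x-x v~w (inj₁ (refl , v~w′)) (inj₁ (_ , w~w′)) = _ , refl , v~w′ , w~w′
  triangle-x-x v~w (inj₁ (refl , v~w′)) (inj₂ (fwd () , _))
  triangle-x-x v~w (inj₁ (refl , v~w′)) (inj₂ (bwd () , _))
  triangle-x-x v~w (inj₂ (fwd (xy _ _) , refl)) (inj₂ (_ , refl)) = ⊥-elim (C.~-irrefl refl v~w)

  ¬edgeInTwoTriangles-x : ∀ i v → ¬ EdgeInTwoTriangles (G₇□C n 3≤n) (x i , v)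
  ¬edgeInTwoTriangles-x i v
    ((_ , w) , b , c , inj₁ (refl , v~w) , b≢c , (u~b , a~b) , (u~c , a~c))
    with triangle-x-x v~w u~b a~b | triangle-x-x v~w u~c a~c
  ... | _ , refl , v~w₁ , w~w₁ | _ , refl , v~w₂ , w~w₂ =
    -- One of the two cycle neighbours of `v` is `w`; both third vertices must lie over the other
    -- one.
    b≢c (cong (x i ,_) (pair-unique (∈nbrs v~w) (∈nbrs v~w₁) (∈nbrs v~w₂)
      (λ eq → C.~-irrefl eq w~w₁) (λ eq → C.~-irrefl eq w~w₂)))
    where
    ∈nbrs : ∀ {z} → v C.~ z → z ∈ C.nbrs v
    ∈nbrs = Equivalence.from C.∈-nbrs
  ¬edgeInTwoTriangles-x i v
    ((_ , _) , b , c , inj₂ (fwd (xy _ j) , refl) , b≢c , (u~b , a~b) , (u~c , a~c))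
    with triangle-x-y u~b a~b | triangle-x-y u~c a~c
  ... | _ , refl , e | _ , refl , e′ = b≢c (cong (λ k → y k , v) (mate-unique e e′))

  ¬cayley : ¬ IsCayleyGraph (G₇□C n 3≤n)
  ¬cayley cayley = ¬edgeInTwoTriangles-x 0F v
    (cayley-homogeneous (G₇□C n 3≤n) cayley (y 0F , v) (x 0F , v) (edgeInTwoTriangles-y v))
    where
    v : Fin n
    v = fromℕ< (ℕ.<-≤-trans ℕ.z<s 3≤n)

  G₇□C-regular : Regular (G₇□C n 3≤n) 6
  G₇□C-regular (x _ , _) = refl
  G₇□C-regular (y _ , _) = refl

-- Number of vertices and conclusion

V₇↔Fin7 : V₇ ↔ Fin 7
V₇↔Fin7 = ↔-sym (+↔⊎ {3} {4}) ↔-∘ mk↔ₛ′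
  (λ { (x i) → inj₁ i ; (y j) → inj₂ j })
  (λ { (inj₁ i) → x i ; (inj₂ j) → y j })
  (λ { (inj₁ _) → refl ; (inj₂ _) → refl })
  (λ { (x _) → refl ; (y _) → refl })

mainTheorem12 : Regular G₇ 4
    × (Σ[ size ∈ (ℕ → ℕ) ]
    ((∀ (n : ℕ) (3≤n : 3 ≤ n) → HasSize (G₇□C n 3≤n) (size n))
    × (∀ (m n : ℕ) → 3 ≤ m → m < n → size m < size n)))
    × (∀ (n : ℕ) (3≤n : 3 ≤ n) → Regular (G₇□C n 3≤n) 6)
    × (∀ (n : ℕ) (3≤n : 3 ≤ n) → CD[0,∞] (G₇□C n 3≤n))
    × (∀ (n : ℕ) (3≤n : 3 ≤ n) → ¬ IsCayleyGraph (G₇□C n 3≤n))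
mainTheorem12 =
  (λ { (x _) → refl ; (y _) → refl }) ,
  ((7 ℕ.*_) ,
   (λ n _ → ↔-sym *↔× ↔-∘ (V₇↔Fin7 ×-↔ ↔-id (Fin n))) ,
   (λ _ _ _ → ℕ.*-monoʳ-< 7)) ,
  G₇□C-regular ,
  (λ n 3≤n → CDℚ⇒CD (G₇□C n 3≤n) (CDℚ-□ G₇ (Cycle n 3≤n) CDℚ-G₇ (CDℚ-Cycle n 3≤n))) ,
  ¬cayley
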